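{- Let $N>0$ be an integer. There is no integer $C$ such that for every integer $n\ge 0$ there exists an integer index $j\ge 0$ (depending on $n$ and $N$) with $$\sum_{i=0}^{2N} P(n+i) = C\cdot P(j).$$
   Context: The Pell numbers are defined by $P(0)=0$, $P(1)=1$ and $P(n)=2P(n-1)+P(n-2)$ for $n\ge 2$. -}

module Defs where

open import Data.Nat using (ℕ; zero; suc; _+_; _*_)
open import Data.List using (applyUpTo; sum)

P : ℕ → ℕ
P zero          = 0
P (suc zero)    = 1
P (suc (suc n)) = 2 * P (suc n) + P n

-- Σ≤ m f = f 0 + f 1 + … + f m, with the upper limit m included.
Σ≤ : ℕ → (ℕ → ℕ) → ℕ
Σ≤ m f = sum (applyUpTo f (suc m))

-- Let s = P(0) + … + P(2N), a = P(2N) and b = P(2N+1).  Then 2s + 1 = a + b, and Cassini's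
-- identity b² = 2ab + a² + 1 turns this into b² = 2s² + 2s + 1.  The cases n = 0 and n = 1
-- make C a divisor of s and of s + b, hence of b and of 1, so s itself would be a Pell number.
-- But a < s since P(2N-1) > 0, and 2s < a + b ≤ 2b, so s lies strictly between the consecutive
-- Pell numbers a and b.
{-# OPTIONS --safe #-}
module Submission where

open import Data.Nat using (ℕ; zero; suc; _+_; _*_; _>_; _≤_; _<_; z≤n; s≤s; _≤′_; ≤′-refl; ≤′-step)
open import Data.Nat.Properties
open import Data.Nat.Divisibility using (_∣_; divides; ∣m+n∣m⇒∣n; ∣m⇒∣m*n; ∣n⇒∣m*n; ∣1⇒≡1)
open import Data.Nat.Tactic.RingSolver using (solve-∀)
open import Data.Integer as ℤ using (ℤ; +_)
open import Data.Integer.Properties using (abs-*)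
open import Data.Product using (∃; _,_)
open import Data.Sum using (inj₁; inj₂)
open import Relation.Nullary using (¬_)
open import Relation.Binary.PropositionalEquality using (_≡_; refl; sym; trans; cong; subst; module ≡-Reasoning)
open import Defs

Σ≤-suc : ∀ f m → Σ≤ (suc m) f ≡ Σ≤ m f + f (suc m)
Σ≤-suc f zero    = trans (cong (_+_ (f 0)) (+-identityʳ (f 1))) (cong (_+ f 1) (sym (+-identityʳ (f 0))))
Σ≤-suc f (suc m) = trans (cong (_+_ (f 0)) (Σ≤-suc (λ i → f (suc i)) m)) (sym (+-assoc (f 0) _ _))

-- Telescoping of 2P(k) = P(k+1) - P(k-1), kept free of subtraction.
1+2ΣP : ∀ m → 1 + 2 * Σ≤ m P ≡ P m + P (suc m)
1+2ΣP zero    = refl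
1+2ΣP (suc m) = begin
  1 + 2 * Σ≤ (suc m) P                 ≡⟨ cong (λ t → 1 + 2 * t) (Σ≤-suc P m) ⟩
  1 + 2 * (Σ≤ m P + P (suc m))         ≡⟨ cong suc (*-distribˡ-+ 2 (Σ≤ m P) (P (suc m))) ⟩
  1 + 2 * Σ≤ m P + 2 * P (suc m)       ≡⟨ cong (_+ 2 * P (suc m)) (1+2ΣP m) ⟩
  P m + P (suc m) + 2 * P (suc m)      ≡⟨ rearrange (P m) (P (suc m)) ⟩
  P (suc m) + (2 * P (suc m) + P m)    ∎
  where
  open ≡-Reasoning
  rearrange : ∀ a b → a + b + 2 * b ≡ b + (2 * b + a)
  rearrange = solve-∀

-- This is P(m+1)P(m-1) - P(m)² = 1 with P(m-1) replaced by P(m+1) - 2P(m). The sign is (-1)^m in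
-- general, so only even m satisfy it.
Cassini : ℕ → Set
Cassini m = let a = P m; b = P (suc m) in b * b ≡ 2 * (a * b) + a * a + 1

P-cassini-even : ∀ N → Cassini (2 * N)
P-cassini-even zero    = refl
P-cassini-even (suc N) =
  -- The index advances by two to preserve the sign. Once it reads 2 + 2N, `P` unfolds and the goal
  -- is a polynomial identity in a and b.
  subst Cassini (sym (*-suc 2 N)) (step (P (2 * N)) (P (suc (2 * N))) (P-cassini-even N))
  where
  -- One of the 25 copies of b² is split off, for the hypothesis to replace.
  expandˡ : ∀ a b → (2 * (2 * b + a) + b) * (2 * (2 * b + a) + b)
                  ≡ 24 * (b * b) + 20 * (a * b) + 4 * (a * a) + b * b
  expandˡ = solve-∀
  expandʳ : ∀ a b → 24 * (b * b) + 20 * (a * b) + 4 * (a * a) + (2 * (a * b) + a * a + 1)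
                  ≡ 2 * ((2 * b + a) * (2 * (2 * b + a) + b)) + (2 * b + a) * (2 * b + a) + 1
  expandʳ = solve-∀
  step : ∀ a b → b * b ≡ 2 * (a * b) + a * a + 1 →
         (2 * (2 * b + a) + b) * (2 * (2 * b + a) + b)
       ≡ 2 * ((2 * b + a) * (2 * (2 * b + a) + b)) + (2 * b + a) * (2 * b + a) + 1
  step a b eq = trans (expandˡ a b)
    (trans (cong (_+_ (24 * (b * b) + 20 * (a * b) + 4 * (a * a))) eq) (expandʳ a b))

-- The right side is a multiple of s plus 1, so a common divisor of s and b divides 1. The proof
-- doubles: 2b² = (a + b)² + 1, where a + b = 1 + 2s.
P²-via-ΣP : ∀ N → let s = Σ≤ (2 * N) P; b = P (suc (2 * N)) in b * b ≡ (2 * s + 2) * s + 1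
P²-via-ΣP N = *-cancelˡ-≡ _ _ 2 (begin
  2 * (b * b)                             ≡⟨ cong (_+_ (b * b)) (+-identityʳ (b * b)) ⟩
  b * b + b * b                           ≡⟨ cong (_+_ (b * b)) (P-cassini-even N) ⟩
  b * b + (2 * (a * b) + a * a + 1)       ≡⟨ square a b ⟩
  (a + b) * (a + b) + 1                   ≡⟨ cong (λ t → t * t + 1) (1+2ΣP (2 * N)) ⟨
  (1 + 2 * s) * (1 + 2 * s) + 1           ≡⟨ halve s ⟩
  2 * ((2 * s + 2) * s + 1)               ∎)
  where
  open ≡-Reasoning
  s = Σ≤ (2 * N) P
  a = P (2 * N)
  b = P (suc (2 * N))
  square : ∀ x y → y * y + (2 * (x * y) + x * x + 1) ≡ (x + y) * (x + y) + 1
  square = solve-∀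
  halve : ∀ x → (1 + 2 * x) * (1 + 2 * x) + 1 ≡ 2 * ((2 * x + 2) * x + 1)
  halve = solve-∀

common-divisor≡1 : ∀ N {c} → c ∣ Σ≤ (2 * N) P → c ∣ Σ≤ (2 * N) (λ i → P (1 + i)) → c ≡ 1
common-divisor≡1 N {c} c∣s c∣s+b =
  ∣1⇒≡1 (∣m+n∣m⇒∣n (subst (c ∣_) (P²-via-ΣP N) (∣m⇒∣m*n _ c∣b)) (∣n⇒∣m*n (2 * Σ≤ (2 * N) P + 2) c∣s))
  where
  c∣b : c ∣ P (suc (2 * N))
  -- Since P(0) = 0 computes away, the shifted sum is definitionally `Σ≤ (suc (2 * N)) P`, that is,
  -- s + b after splitting off the last term.
  c∣b = ∣m+n∣m⇒∣n (subst (c ∣_) (Σ≤-suc P (2 * N)) c∣s+b) c∣s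

P[n]≤P[1+n] : ∀ n → P n ≤ P (suc n)
P[n]≤P[1+n] zero    = z≤n
P[n]≤P[1+n] (suc n) = ≤-trans (m≤m+n _ _) (m≤m+n _ (P n))

P-mono-≤ : ∀ {m n} → m ≤ n → P m ≤ P n
P-mono-≤ m≤n = go (≤⇒≤′ m≤n)
  where
  go : ∀ {m n} → m ≤′ n → P m ≤ P n
  go ≤′-refl           = ≤-refl
  go (≤′-step {n} m≤n) = ≤-trans (go m≤n) (P[n]≤P[1+n] n)

P-strictly-between : ∀ m {x} → P m < x → x < P (suc m) → ∀ j → ¬ (x ≡ P j)
P-strictly-between m Pm<x x<Pm′ j refl with ≤-<-connex j m
... | inj₁ j≤m = <⇒≱ Pm<x (P-mono-≤ j≤m)
... | inj₂ m<j = <⇒≱ x<Pm′ (P-mono-≤ m<j)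

ΣP<P : ∀ m → Σ≤ m P < P (suc m)
ΣP<P m = *-cancelˡ-< 2 _ _ (begin
  suc (2 * Σ≤ m P)        ≡⟨ 1+2ΣP m ⟩
  P m + P (suc m)         ≤⟨ +-mono-≤ (P[n]≤P[1+n] m) (m≤m+n _ 0) ⟩
  2 * P (suc m)           ∎)
  where open ≤-Reasoning

-- From index 2 on, the earlier terms include P(1) = 1, so their sum computes to a successor. At
-- indices 0 and 1 the two sides are equal.
P<ΣP : ∀ m → P (2 + m) < Σ≤ (2 + m) P
P<ΣP m = subst (P (2 + m) <_) (sym (Σ≤-suc P (suc m))) (m<n+m (P (2 + m)) {Σ≤ (suc m) P} (s≤s z≤n))

ΣP-not-Pell : ∀ N → N > 0 → ∀ j → ¬ (Σ≤ (2 * N) P ≡ P j)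
ΣP-not-Pell (suc N) _ =
  -- A positive N puts the upper limit in the form 2 + m that `P<ΣP` requires.
  subst (λ m → ∀ j → ¬ (Σ≤ m P ≡ P j)) (sym (*-suc 2 N))
    (P-strictly-between (2 + 2 * N) (P<ΣP (2 * N)) (ΣP<P (2 + 2 * N)))

theorem4p3 : ∀ (N : ℕ) → N > 0 →
    ¬ (∃ λ (C : ℤ) → ∀ (n : ℕ) → ∃ λ (j : ℕ) → + (Σ≤ (2 * N) (λ i → P (n + i))) ≡ C ℤ.* + (P j))
theorem4p3 N N>0 (C , rep) = contra (rep 0) (rep 1)
  where
  -- Absolute values carry the equation into ℕ, which also covers negative `C`.
  abs-rep : ∀ {x} j → + x ≡ C ℤ.* + (P j) → x ≡ ℤ.∣ C ∣ * P j
  abs-rep j eq = trans (cong ℤ.∣_∣ eq) (abs-* C (+ P j))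

  ∣C∣-divides : ∀ {x} j → + x ≡ C ℤ.* + (P j) → ℤ.∣ C ∣ ∣ x
  ∣C∣-divides j eq = divides (P j) (trans (abs-rep j eq) (*-comm ℤ.∣ C ∣ (P j)))

  contra : (∃ λ j → + (Σ≤ (2 * N) P) ≡ C ℤ.* + (P j)) →
           ¬ (∃ λ j → + (Σ≤ (2 * N) (λ i → P (1 + i))) ≡ C ℤ.* + (P j))
  contra (j , eq₀) (k , eq₁) = ΣP-not-Pell N N>0 j (begin
    Σ≤ (2 * N) P      ≡⟨ abs-rep j eq₀ ⟩
    ℤ.∣ C ∣ * P j     ≡⟨ cong (_* P j) (common-divisor≡1 N (∣C∣-divides j eq₀) (∣C∣-divides k eq₁)) ⟩
    1 * P j           ≡⟨ *-identityˡ (P j) ⟩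
    P j               ∎)
    where open ≡-Reasoning
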